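{- Let $n\ge1$ and let $\lambda$ be a partition. The sequence of dual stable Grothendieck polynomials $\{g_{k\lambda}(\mathbf{x})\}_{k=1}^\infty$ in the variables $\mathbf{x}=(x_1,\dots,x_n)$ satisfies a linear recurrence.
   Context: $k\lambda$ is obtained from $\lambda$ by multiplying every part by $k$. The dual stable Grothendieck polynomial in $n$ variables is $$g_\lambda(\mathbf{x})=\sum_{T\in\mathrm{RPP}(\lambda)}\mathbf{x}^{ev(T)},$$ where $\mathrm{RPP}(\lambda)$ is the set of reverse plane partitions of shape $\lambda$, i.e. fillings of the Young diagram of $\lambda$ with numbers in $\{1,\dots,n\}$ such that rows and columns are weakly decreasing, and $ev(T)=(ev(T)_1,\dots,ev(T)_n)$ with $ev(T)_i$ the total number of columns of $T$ in which $i$ appears. A sequence $\{a_k\}_{k\ge1}$ of polynomials satisfies a linear recurrence if there are $r\ge1$ and polynomials $c_1,\dots,c_r$ in the given variables, independent of $k$, such that $a_k+c_1a_{k-1}+\dots+c_ra_{k-r}=0$ for all $k\ge r+1$. -}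

module Defs where

open import Data.Bool.Base using (if_then_else_)
open import Data.Fin.Base as Fin using (Fin; zero; suc; toℕ)
import Data.Fin.Properties as Fin
open import Data.Integer.Base as ℤ using (ℤ; 0ℤ; 1ℤ)
open import Data.List.Base as List
  using (List; []; _∷_; _++_; map; allFin; cartesianProductWith; filter; length; lookup)
open import Data.List.Relation.Unary.All using (All; []; _∷_)
open import Data.List.Relation.Unary.Linked as Linked using (Linked)
import Data.List.Relation.Unary.Linked.Properties as Linked
open import Data.Nat.Base as ℕ using (ℕ; zero; suc; _≤_; _≥_; _∸_)
import Data.Nat.Properties as ℕ
open import Data.Product.Base using (_×_; _,_; ∃-syntax; Σ-syntax)
open import Data.Vec.Base as Vec using (Vec; []; _∷_)
import Data.Vec.Functional as F
import Data.Vec.Properties as Vec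
open import Relation.Binary.PropositionalEquality using (_≡_)
open import Relation.Nullary.Decidable using (Dec; does; _×-dec_; _→-dec_)

-- Polynomials in x₁,…,xₙ with integer coefficients, as finite formal sums of
-- terms (c , e) standing for c · x₁^e₁ ⋯ xₙ^eₙ. The same exponent vector may
-- occur several times, so equality of polynomials is _≈_, not _≡_.

Exponent : ℕ → Set
Exponent n = Vec ℕ n

Polynomial : ℕ → Set
Polynomial n = List (ℤ × Exponent n)

coeff : ∀ {n} → Polynomial n → Exponent n → ℤ
coeff []             m = 0ℤ
coeff ((c , e) ∷ p) m =
  if does (Vec.≡-dec ℕ._≟_ e m) then c ℤ.+ coeff p m else coeff p m

infix  4 _≈_
infixl 6 _+_
infixl 7 _*_

_≈_ : ∀ {n} → Polynomial n → Polynomial n → Set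
p ≈ q = ∀ m → coeff p m ≡ coeff q m

0# : ∀ {n} → Polynomial n
0# = []

_+_ : ∀ {n} → Polynomial n → Polynomial n → Polynomial n
_+_ = _++_

_*_ : ∀ {n} → Polynomial n → Polynomial n → Polynomial n
_*_ = cartesianProductWith λ (c , e) (d , f) → (c ℤ.* d , Vec.zipWith ℕ._+_ e f)

∑ : ∀ {n r} → (Fin r → Polynomial n) → Polynomial n
∑ = F.foldr _+_ 0#

-- The monomial x₁^e₁ ⋯ xₙ^eₙ.
x^_ : ∀ {n} → Exponent n → ℤ × Exponent n
x^ e = (1ℤ , e)

-- The value a 0 is never used: sequences are indexed from 1, and k ≥ r + 1
-- makes every index k ∸ suc i (with i < r) a genuine difference that is ≥ 1.
-- The polynomial c i is the one usually written c_{i+1}.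
SatisfiesLinearRecurrence : ∀ {n} → (ℕ → Polynomial n) → Set
SatisfiesLinearRecurrence {n} a =
  Σ[ r ∈ ℕ ] r ≥ 1 × (Σ[ c ∈ (Fin r → Polynomial n) ]
    (∀ k → k ≥ suc r → a k + ∑ (λ i → c i * a (k ∸ suc (toℕ i))) ≈ 0#))

-- Trailing zero parts are allowed; they contribute no cells to the diagram.
record Partition : Set where
  constructor mkPartition
  field
    parts      : List ℕ
    decreasing : Linked _≥_ parts

open Partition public

infixr 7 _·_

_·_ : ℕ → Partition → Partition
parts      (k · π) = map (k ℕ.*_) (parts π)
decreasing (k · π) = Linked.map⁺ (Linked.map (ℕ.*-monoʳ-≤ k) (decreasing π))

largestPart : List ℕ → ℕ
largestPart = List.foldr ℕ._⊔_ 0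

-- Fillings, listed row by row, of the Young diagram with the given row lengths.
-- The element v of Fin n stands for the number 1 + toℕ v in {1,…,n}.
Filling : ℕ → List ℕ → Set
Filling n = All (Vec (Fin n))

entry : ∀ {n ps} → Filling n ps → (i : Fin (length ps)) → Fin (lookup ps i) → Fin n
entry (row ∷ _) zero    j = Vec.lookup row j
entry (_   ∷ T) (suc i) j = entry T i j

RowsDecreasing : ∀ {n ps} → Filling n ps → Set
RowsDecreasing T = ∀ i j j′ → j Fin.≤ j′ → entry T i j′ Fin.≤ entry T i j

ColumnsDecreasing : ∀ {n ps} → Filling n ps → Set
ColumnsDecreasing T =
  ∀ i i′ j j′ → i Fin.≤ i′ → toℕ j ≡ toℕ j′ → entry T i′ j′ Fin.≤ entry T i j

IsRPP : ∀ {n ps} → Filling n ps → Set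
IsRPP T = RowsDecreasing T × ColumnsDecreasing T

isRPP? : ∀ {n ps} (T : Filling n ps) → Dec (IsRPP T)
isRPP? T =
  (Fin.all? λ i → Fin.all? λ j → Fin.all? λ j′ →
    (j Fin.≤? j′) →-dec (entry T i j′ Fin.≤? entry T i j))
  ×-dec
  (Fin.all? λ i → Fin.all? λ i′ → Fin.all? λ j → Fin.all? λ j′ →
    (i Fin.≤? i′) →-dec ((toℕ j ℕ.≟ toℕ j′) →-dec
      (entry T i′ j′ Fin.≤? entry T i j)))

allRows : ∀ n m → List (Vec (Fin n) m)
allRows n zero    = [] ∷ []
allRows n (suc m) = cartesianProductWith _∷_ (allFin n) (allRows n m)

-- Every filling occurs exactly once in this list.
allFillings : ∀ n ps → List (Filling n ps)
allFillings n []       = [] ∷ []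
allFillings n (p ∷ ps) = cartesianProductWith _∷_ (allRows n p) (allFillings n ps)

RPPs : ∀ n ps → List (Filling n ps)
RPPs n ps = filter isRPP? (allFillings n ps)

AppearsInColumn : ∀ {n ps} → Filling n ps → Fin n → ℕ → Set
AppearsInColumn T v c = ∃[ i ] ∃[ j ] toℕ j ≡ c × entry T i j ≡ v

appearsInColumn? : ∀ {n ps} (T : Filling n ps) v c → Dec (AppearsInColumn T v c)
appearsInColumn? T v c =
  Fin.any? λ i → Fin.any? λ j → (toℕ j ℕ.≟ c) ×-dec (entry T i j Fin.≟ v)

ev : ∀ {n ps} → Filling n ps → Exponent n
ev {ps = ps} T = Vec.tabulate λ v →
  length (filter (appearsInColumn? T v) (List.upTo (largestPart ps)))

dualStableGrothendieck : ∀ n → Partition → Polynomial n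
dualStableGrothendieck n π = map (λ T → x^ ev T) (RPPs n (parts π))

{-# OPTIONS --safe #-}

-- Read a reverse plane partition from left to right, one column at a time.
-- The weight is multiplicative over the columns, and a column may follow
-- another exactly when it is componentwise at most as large, so summing over
-- all fillings multiplies transfer matrices that are triangular for the
-- componentwise order. Each column of λ becomes k consecutive columns of the
-- same height in kλ, so g_{kλ} is a sum of entries of M₁ᵏ M₂ᵏ ⋯, with Mⱼ the
-- transfer matrix for the height of the j-th column of λ. By triangularity the
-- entries of each Mⱼᵏ, as sequences in k, are killed by operators ∏ᵢ (E − dᵢ),
-- where E is the shift; such sequences are closed under sums and products, and
-- expanding ∏ᵢ (E − dᵢ) gives the recurrence.

module Submission where

open import Defs hiding (_≈_; _+_; _*_; 0#)
open import Algebra.Bundles using (CommutativeRing)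
import Algebra.Properties.CommutativeSemigroup as CommutativeSemigroupProperties
import Algebra.Solver.Ring.NaturalCoefficients.Default as NaturalCoefficients
open import Data.Bool.Base using (true; false; if_then_else_)
open import Data.Fin.Base as Fin using (Fin; zero; suc; toℕ)
import Data.Fin.Properties as Fin
import Data.Integer.Base as ℤ hiding (+_)
open ℤ using (ℤ; 0ℤ; 1ℤ)
import Data.Integer.Properties as ℤ
open import Data.List.Base as List
  using (List; []; _∷_; _++_; map; allFin; applyUpTo; cartesianProductWith; filter; length; lookup; replicate)
open import Data.List.Membership.Propositional using (_∈_)
import Data.List.Properties as List
open import Data.List.Relation.Binary.Pointwise.Base using (Pointwise; []; _∷_)
import Data.List.Relation.Binary.Pointwise as Pointwise
open import Data.List.Relation.Unary.All as All using (All; []; _∷_)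
import Data.List.Relation.Unary.All.Properties as All
open import Data.List.Relation.Unary.AllPairs as AllPairs using (AllPairs; []; _∷_)
open import Data.List.Relation.Unary.Any using (here; there)
open import Data.Nat.Base as ℕ using (ℕ; zero; suc; pred; _≤_; _<_; _≥_; _∸_; z≤n; s≤s)
open import Data.Nat.Induction using (<-wellFounded)
import Data.Nat.ListAction as ℕ
import Data.Nat.Properties as ℕ
open import Data.List.Membership.DecPropositional ℕ._≟_ using (_∈?_)
open import Data.Product.Base using (_×_; _,_; proj₁; proj₂; ∃-syntax; Σ-syntax)
open import Data.Sum.Base using (_⊎_; inj₁; inj₂)
open import Data.Vec.Base as Vec using (Vec; []; _∷_)
import Data.Vec.Functional as F
import Data.Vec.Properties as Vec
open import Function.Base using (_∘_; id)
open import Function.Bundles using (_⇔_; mk⇔; Equivalence)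
open import Induction.WellFounded using (Acc; acc)
open import Level using (0ℓ) renaming (_⊔_ to _⊔ˡ_)
open import Relation.Binary.PropositionalEquality as ≡
  using (_≡_; refl; sym; trans; cong; cong₂; subst)
open import Relation.Nullary using (Dec; yes; no; does; ¬_; contradiction)
open import Relation.Nullary.Decidable using (_×-dec_; _⊎-dec_)
open import Relation.Unary using (Decidable)

-- The ring of polynomials

module Polynomials where

  open Defs using (_≈_; _+_; _*_; 0#)

  private
    infixl 6 _⊕_
    infixl 7 _⊛_

    _⊕_ : ∀ {n} → Exponent n → Exponent n → Exponent n
    _⊕_ = Vec.zipWith ℕ._+_

    _⊛_ : ∀ {n} → ℤ × Exponent n → ℤ × Exponent n → ℤ × Exponent n
    (c , e) ⊛ (d , f) = c ℤ.* d , e ⊕ f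

  ⊕-cancelˡ : ∀ {n} (e : Exponent n) {f g} → e ⊕ f ≡ e ⊕ g → f ≡ g
  ⊕-cancelˡ []      {[]}    {[]}    _  = refl
  ⊕-cancelˡ (k ∷ e) {_ ∷ _} {_ ∷ _} eq =
    cong₂ _∷_ (ℕ.+-cancelˡ-≡ k _ _ (Vec.∷-injectiveˡ eq)) (⊕-cancelˡ e (Vec.∷-injectiveʳ eq))

  -- Multiplying by the monomial with exponent `e` moves the coefficient at `f` to `e ⊕ f` and
  -- leaves 0 at every other exponent, so coefficients of such a product are found by deciding
  -- divisibility.
  _divides?_ : ∀ {n} (e m : Exponent n) → Dec (∃[ f ] e ⊕ f ≡ m)
  []      divides? []      = yes ([] , refl)
  (k ∷ e) divides? (l ∷ m) with k ℕ.≤? l | e divides? m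
  ... | yes k≤l | yes (f , refl) = yes (l ∸ k ∷ f , cong (_∷ _) (ℕ.m+[n∸m]≡n k≤l))
  ... | no k≰l  | _              = no λ where
    (j ∷ f , eq) → k≰l (subst (k ≤_) (Vec.∷-injectiveˡ eq) (ℕ.m≤m+n k j))
  ... | yes _   | no ∤           = no λ where (j ∷ f , eq) → ∤ (f , Vec.∷-injectiveʳ eq)

  module _ {n : ℕ} where

    private
      P : Set
      P = Polynomial n

    ⊕-assoc : ∀ (e f g : Exponent n) → (e ⊕ f) ⊕ g ≡ e ⊕ (f ⊕ g)
    ⊕-assoc = Vec.zipWith-assoc ℕ.+-assoc

    ⊕-comm : ∀ (e f : Exponent n) → e ⊕ f ≡ f ⊕ e
    ⊕-comm = Vec.zipWith-comm ℕ.+-comm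

    ⊕-identityˡ : ∀ (e : Exponent n) → Vec.replicate n 0 ⊕ e ≡ e
    ⊕-identityˡ = Vec.zipWith-identityˡ ℕ.+-identityˡ

    ⊛-assoc : ∀ (s t u : ℤ × Exponent n) → (s ⊛ t) ⊛ u ≡ s ⊛ (t ⊛ u)
    ⊛-assoc (b , e) (c , f) (d , g) = cong₂ _,_ (ℤ.*-assoc b c d) (⊕-assoc e f g)

    ⊛-comm : ∀ (s t : ℤ × Exponent n) → s ⊛ t ≡ t ⊛ s
    ⊛-comm (c , e) (d , f) = cong₂ _,_ (ℤ.*-comm c d) (⊕-comm e f)

    coeff-+ : ∀ (p q : P) m → coeff (p + q) m ≡ coeff p m ℤ.+ coeff q m
    coeff-+ []            q m = sym (ℤ.+-identityˡ _)
    coeff-+ ((c , e) ∷ p) q m with does (Vec.≡-dec ℕ._≟_ e m)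
    ... | true  = trans (cong (c ℤ.+_) (coeff-+ p q m)) (sym (ℤ.+-assoc c _ _))
    ... | false = coeff-+ p q m

    coeff-⊛ : ∀ c e (q : P) m → coeff (map ((c , e) ⊛_) q) (e ⊕ m) ≡ c ℤ.* coeff q m
    coeff-⊛ c e []            m = sym (ℤ.*-zeroʳ c)
    coeff-⊛ c e ((d , f) ∷ q) m
      with Vec.≡-dec ℕ._≟_ (e ⊕ f) (e ⊕ m) | Vec.≡-dec ℕ._≟_ f m
    ... | yes _ | yes _  = trans (cong (c ℤ.* d ℤ.+_) (coeff-⊛ c e q m)) (sym (ℤ.*-distribˡ-+ c d _))
    ... | no _  | no _   = coeff-⊛ c e q m
    ... | yes p | no ¬p  = contradiction (⊕-cancelˡ e p) ¬p
    ... | no ¬p | yes p  = contradiction (cong (e ⊕_) p) ¬p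

    coeff-⊛-∤ : ∀ c e (q : P) m → ¬ (∃[ f ] e ⊕ f ≡ m) → coeff (map ((c , e) ⊛_) q) m ≡ 0ℤ
    coeff-⊛-∤ c e []            m ∤ = refl
    coeff-⊛-∤ c e ((d , f) ∷ q) m ∤ with Vec.≡-dec ℕ._≟_ (e ⊕ f) m
    ... | yes p = contradiction (f , p) ∤
    ... | no _  = coeff-⊛-∤ c e q m ∤

    +-cong : {p p′ q q′ : P} → p ≈ p′ → q ≈ q′ → p + q ≈ p′ + q′
    +-cong {p} {p′} {q} {q′} p≈p′ q≈q′ m = trans (coeff-+ p q m)
      (trans (cong₂ ℤ._+_ (p≈p′ m) (q≈q′ m)) (sym (coeff-+ p′ q′ m)))

    +-comm : ∀ (p q : P) → p + q ≈ q + p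
    +-comm p q m = trans (coeff-+ p q m) (trans (ℤ.+-comm (coeff p m) _) (sym (coeff-+ q p m)))

    -_ : P → P
    -_ = map λ (c , e) → ℤ.- c , e

    coeff-neg : ∀ p m → coeff (- p) m ≡ ℤ.- coeff p m
    coeff-neg []            m = refl
    coeff-neg ((c , e) ∷ p) m with does (Vec.≡-dec ℕ._≟_ e m)
    ... | true  = trans (cong (ℤ.- c ℤ.+_) (coeff-neg p m)) (sym (ℤ.neg-distrib-+ c _))
    ... | false = coeff-neg p m

    -‿cong : ∀ {p q} → p ≈ q → - p ≈ - q
    -‿cong {p} {q} p≈q m = trans (coeff-neg p m) (trans (cong ℤ.-_ (p≈q m)) (sym (coeff-neg q m)))

    +-inverseʳ : ∀ p → p + - p ≈ 0#
    +-inverseʳ p m = trans (coeff-+ p (- p) m)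
      (trans (cong (coeff p m ℤ.+_) (coeff-neg p m)) (ℤ.+-inverseʳ (coeff p m)))

    ⊛-congʳ : ∀ t {p q : P} → p ≈ q → map (t ⊛_) p ≈ map (t ⊛_) q
    ⊛-congʳ (c , e) {p} {q} p≈q m with e divides? m
    ... | yes (f , refl) = trans (coeff-⊛ c e p f) (trans (cong (c ℤ.*_) (p≈q f)) (sym (coeff-⊛ c e q f)))
    ... | no ∤           = trans (coeff-⊛-∤ c e p m ∤) (sym (coeff-⊛-∤ c e q m ∤))

    *-congʳ : ∀ p {q q′ : P} → q ≈ q′ → p * q ≈ p * q′
    *-congʳ []      q≈q′ m = refl
    *-congʳ (t ∷ p) {q} {q′} q≈q′ =
      +-cong {map (t ⊛_) q} {map (t ⊛_) q′} {p * q} {p * q′} (⊛-congʳ t {q} {q′} q≈q′) (*-congʳ p q≈q′)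

    -- The product recurses on its left factor; this is the matching expansion in the right factor,
    -- from which commutativity follows. The two sides list their terms in different orders, so only
    -- coefficients can agree.
    *-∷ : ∀ (q : P) t p → q * (t ∷ p) ≈ map (t ⊛_) q + q * p
    *-∷ []      t p m = refl
    *-∷ (s ∷ q) t p m = begin
      coeff (s ⊛ t ∷ map (s ⊛_) p ++ q * (t ∷ p)) m
        ≡⟨ coeff-+ (s ⊛ t ∷ []) (map (s ⊛_) p ++ q * (t ∷ p)) m ⟩
      coeff (s ⊛ t ∷ []) m ℤ.+ coeff (map (s ⊛_) p ++ q * (t ∷ p)) m
        ≡⟨ cong₂ ℤ._+_ (cong (λ u → coeff (u ∷ []) m) (⊛-comm s t)) (begin
          coeff (map (s ⊛_) p ++ q * (t ∷ p)) m
            ≡⟨ coeff-+ (map (s ⊛_) p) (q * (t ∷ p)) m ⟩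
          coeff (map (s ⊛_) p) m ℤ.+ coeff (q * (t ∷ p)) m
            ≡⟨ cong (coeff (map (s ⊛_) p) m ℤ.+_) (trans (*-∷ q t p m) (coeff-+ (map (t ⊛_) q) (q * p) m)) ⟩
          coeff (map (s ⊛_) p) m ℤ.+ (coeff (map (t ⊛_) q) m ℤ.+ coeff (q * p) m)
            ≡⟨ x∙yz≈y∙xz (coeff (map (s ⊛_) p) m) (coeff (map (t ⊛_) q) m) (coeff (q * p) m) ⟩
          coeff (map (t ⊛_) q) m ℤ.+ (coeff (map (s ⊛_) p) m ℤ.+ coeff (q * p) m)
            ≡⟨ cong (coeff (map (t ⊛_) q) m ℤ.+_) (coeff-+ (map (s ⊛_) p) (q * p) m) ⟨
          coeff (map (t ⊛_) q) m ℤ.+ coeff (map (s ⊛_) p ++ q * p) m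
            ≡⟨ coeff-+ (map (t ⊛_) q) (map (s ⊛_) p ++ q * p) m ⟨
          coeff (map (t ⊛_) q ++ (map (s ⊛_) p ++ q * p)) m ∎) ⟩
      coeff (t ⊛ s ∷ []) m ℤ.+ coeff (map (t ⊛_) q ++ (map (s ⊛_) p ++ q * p)) m
        ≡⟨ coeff-+ (t ⊛ s ∷ []) (map (t ⊛_) q ++ (map (s ⊛_) p ++ q * p)) m ⟨
      coeff (t ⊛ s ∷ map (t ⊛_) q ++ (map (s ⊛_) p ++ q * p)) m ∎
      where
      open ≡.≡-Reasoning
      open CommutativeSemigroupProperties ℤ.+-commutativeSemigroup using (x∙yz≈y∙xz)

    *-comm : ∀ (p q : P) → p * q ≈ q * p
    *-comm []      q m = cong (λ r → coeff r m) (sym (List.cartesianProductWith-zeroʳ _⊛_ q))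
    *-comm (t ∷ p) q m = trans
      (+-cong {map (t ⊛_) q} {map (t ⊛_) q} {p * q} {q * p} (λ _ → refl) (*-comm p q) m)
      (sym (*-∷ q t p m))

    *-cong : ∀ {p p′ q q′ : P} → p ≈ p′ → q ≈ q′ → p * q ≈ p′ * q′
    *-cong {p} {p′} {q} {q′} p≈p′ q≈q′ m = trans (*-congʳ p q≈q′ m)
      (trans (*-comm p q′ m) (trans (*-congʳ q′ p≈p′ m) (*-comm q′ p′ m)))

    ⊛-*-assoc : ∀ t (p q : P) → map (t ⊛_) p * q ≡ map (t ⊛_) (p * q)
    ⊛-*-assoc t []      q = refl
    ⊛-*-assoc t (s ∷ p) q = begin
      map ((t ⊛ s) ⊛_) q ++ map (t ⊛_) p * q
        ≡⟨ cong₂ _++_ (trans (List.map-cong (⊛-assoc t s) q) (List.map-∘ q)) (⊛-*-assoc t p q) ⟩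
      map (t ⊛_) (map (s ⊛_) q) ++ map (t ⊛_) (p * q)
        ≡⟨ List.map-++ (t ⊛_) (map (s ⊛_) q) (p * q) ⟨
      map (t ⊛_) (map (s ⊛_) q ++ p * q) ∎
      where open ≡.≡-Reasoning

    -- Both bracketings enumerate the triples of terms in the same lexicographic order, so the lists
    -- themselves are equal.
    *-assoc : ∀ (p q r : P) → (p * q) * r ≡ p * (q * r)
    *-assoc []      q r = refl
    *-assoc (t ∷ p) q r = trans
      (List.cartesianProductWith-distribʳ-++ _⊛_ (map (t ⊛_) q) (p * q) r)
      (cong₂ _++_ (⊛-*-assoc t q r) (*-assoc p q r))

    *-identityˡ : ∀ (p : P) → ((1ℤ , Vec.replicate n 0) ∷ []) * p ≡ p
    *-identityˡ p = trans (List.++-identityʳ _) (trans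
      (List.map-cong (λ (c , e) → cong₂ _,_ (ℤ.*-identityˡ c) (⊕-identityˡ e)) p) (List.map-id p))

  polynomialRing : ℕ → CommutativeRing 0ℓ 0ℓ
  polynomialRing n = record
    { Carrier = Polynomial n
    ; _≈_     = _≈_
    ; _+_     = _+_
    ; _*_     = _*_
    ; -_      = -_
    ; 0#      = 0#
    ; 1#      = 1ᴾ
    ; isCommutativeRing = record
      { isRing = record
        { +-isAbelianGroup = record
          { isGroup = record
            { isMonoid = record
              { isSemigroup = record
                { isMagma = record
                  { isEquivalence = record
                    { refl  = λ _ → refl
                    ; sym   = λ p≈q m → sym (p≈q m)
                    ; trans = λ p≈q q≈r m → trans (p≈q m) (q≈r m)
                    }
                  ; ∙-cong = λ {p} {p′} {q} {q′} → +-cong {p = p} {p′} {q} {q′}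
                  }
                ; assoc = λ p q r → reflexive (List.++-assoc p q r)
                }
              ; identity = (λ _ _ → refl) , (λ p → reflexive (List.++-identityʳ p))
              }
            ; inverse = (λ p m → trans (+-comm (- p) p m) (+-inverseʳ p m)) , +-inverseʳ
            ; ⁻¹-cong = λ {p} {q} → -‿cong {p = p} {q}
            }
          ; comm = +-comm
          }
        ; *-cong     = λ {p} {p′} {q} {q′} → *-cong {p = p} {p′} {q} {q′}
        ; *-assoc    = λ p q r → reflexive (*-assoc p q r)
        ; *-identity = (λ p → reflexive (*-identityˡ p))
                     , (λ p m → trans (*-comm p 1ᴾ m) (reflexive (*-identityˡ p) m))
        ; distrib    = distribˡ , (λ p q r → reflexive (distribʳ p q r))
        }
      ; *-comm = *-comm
      }
    }
    where
    1ᴾ : Polynomial n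
    1ᴾ = (1ℤ , Vec.replicate n 0) ∷ []

    reflexive : ∀ {p q : Polynomial n} → p ≡ q → p ≈ q
    reflexive refl m = refl

    distribʳ : ∀ (p q r : Polynomial n) → (q + r) * p ≡ q * p + r * p
    distribʳ p q r = List.cartesianProductWith-distribʳ-++ _ q r p

    distribˡ : ∀ (p q r : Polynomial n) → p * (q + r) ≈ p * q + p * r
    distribˡ p q r m = trans (*-comm p (q + r) m) (trans (reflexive (distribʳ p q r) m)
      (+-cong {p = q * p} {p * q} {r * p} {p * r} (*-comm q p) (*-comm r p) m))

-- Finite sums over lists in a commutative ring

module ListSum {c ℓ} (R : CommutativeRing c ℓ) where

  open CommutativeRing R hiding (zero)
    renaming (refl to ≈-refl; sym to ≈-sym; trans to ≈-trans; reflexive to ≈-reflexive)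
  open CommutativeSemigroupProperties +-commutativeSemigroup using (interchange)

  infix 5 ∑[_]_
  ∑[_]_ : ∀ {a} {A : Set a} → List A → (A → Carrier) → Carrier
  ∑[ xs ] f = List.foldr (λ x r → f x + r) 0# xs

  module _ {a} {A : Set a} where

    ∑-cong : ∀ (xs : List A) {f g} → (∀ x → f x ≈ g x) → ∑[ xs ] f ≈ ∑[ xs ] g
    ∑-cong []       f≈g = ≈-refl
    ∑-cong (x ∷ xs) f≈g = +-cong (f≈g x) (∑-cong xs f≈g)

    ∑-0 : ∀ (xs : List A) → ∑[ xs ] (λ _ → 0#) ≈ 0#
    ∑-0 []       = ≈-refl
    ∑-0 (x ∷ xs) = ≈-trans (+-identityˡ _) (∑-0 xs)

    ∑-+ : ∀ (xs : List A) f g → ∑[ xs ] (λ x → f x + g x) ≈ (∑[ xs ] f) + (∑[ xs ] g)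
    ∑-+ []       f g = ≈-sym (+-identityˡ 0#)
    ∑-+ (x ∷ xs) f g = ≈-trans (+-congˡ (∑-+ xs f g)) (interchange (f x) (g x) _ _)

    *-∑ : ∀ (xs : List A) r f → r * (∑[ xs ] f) ≈ ∑[ xs ] (λ x → r * f x)
    *-∑ []       r f = zeroʳ r
    *-∑ (x ∷ xs) r f = ≈-trans (distribˡ r _ _) (+-congˡ (*-∑ xs r f))

    ∑-* : ∀ (xs : List A) f r → (∑[ xs ] f) * r ≈ ∑[ xs ] (λ x → f x * r)
    ∑-* xs f r = ≈-trans (*-comm _ r) (≈-trans (*-∑ xs r f) (∑-cong xs λ x → *-comm r (f x)))

    ∑-++ : ∀ (xs ys : List A) f → ∑[ xs ++ ys ] f ≈ (∑[ xs ] f) + (∑[ ys ] f)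
    ∑-++ []       ys f = ≈-sym (+-identityˡ _)
    ∑-++ (x ∷ xs) ys f = ≈-trans (+-congˡ (∑-++ xs ys f)) (≈-sym (+-assoc _ _ _))

  ∑-map : ∀ {a b} {A : Set a} {B : Set b} (g : A → B) xs f → ∑[ map g xs ] f ≡ ∑[ xs ] (λ x → f (g x))
  ∑-map g xs f = List.foldr-map (λ x r → f x + r) g 0# xs

  module _ {a b} {A : Set a} {B : Set b} where

    ∑-swap : ∀ (xs : List A) (ys : List B) (f : A → B → Carrier) →
      ∑[ xs ] (λ x → ∑[ ys ] λ y → f x y) ≈ ∑[ ys ] (λ y → ∑[ xs ] λ x → f x y)
    ∑-swap []       ys f = ≈-sym (∑-0 ys)
    ∑-swap (x ∷ xs) ys f = ≈-trans (+-congˡ (∑-swap xs ys f)) (≈-sym (∑-+ ys (f x) _))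

    ∑-× : ∀ {c} {C : Set c} (g : A → B → C) xs ys f →
      ∑[ cartesianProductWith g xs ys ] f ≈ ∑[ xs ] (λ x → ∑[ ys ] λ y → f (g x y))
    ∑-× g []       ys f = ≈-refl
    ∑-× g (x ∷ xs) ys f = ≈-trans (∑-++ (map (g x) ys) _ f)
      (+-cong (≈-reflexive (∑-map (g x) ys f)) (∑-× g xs ys f))

-- Sequences killed by some ∏ᵢ (E − dᵢ)

module Recurrence {c ℓ} (R : CommutativeRing c ℓ) where

  open CommutativeRing R hiding (zero)
    renaming (refl to ≈-refl; sym to ≈-sym; trans to ≈-trans; reflexive to ≈-reflexive)
  open ListSum R
  open import Relation.Binary.Reasoning.Setoid setoid
  open NaturalCoefficients commutativeSemiring using (solve; _:+_; _:*_; _:=_)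

  private
    Seq : Set c
    Seq = ℕ → Carrier

    variable
      a b : Seq

  -- A derivation carries the scalars dᵢ one at a time: `step d` records (E - d) a = b and continues
  -- with b, and `null` ends at the zero sequence. Closure properties then become inductions on
  -- derivations, with no polynomials in E.
  data SplitRecurrent : Seq → Set (c ⊔ˡ ℓ) where
    null : (∀ k → a k ≈ 0#) → SplitRecurrent a
    step : ∀ d → (∀ k → a (suc k) ≈ d * a k + b k) → SplitRecurrent b → SplitRecurrent a

  resp : (∀ k → a k ≈ b k) → SplitRecurrent a → SplitRecurrent b
  resp a≈b (null a≈0)    = null λ k → ≈-trans (≈-sym (a≈b k)) (a≈0 k)
  resp a≈b (step d eq s) = step d
    (λ k → ≈-trans (≈-sym (a≈b (suc k))) (≈-trans (eq k) (+-congʳ (*-congˡ (a≈b k))))) s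

  const : ∀ r → SplitRecurrent (λ _ → r)
  const r = step 1# (λ _ → ≈-sym (≈-trans (+-identityʳ _) (*-identityˡ r))) (null λ _ → ≈-refl)

  shift : SplitRecurrent a → SplitRecurrent (a ∘ suc)
  shift (null a≈0)    = null (a≈0 ∘ suc)
  shift (step d eq s) = step d (eq ∘ suc) (shift s)

  scale : ∀ r → SplitRecurrent a → SplitRecurrent (λ k → r * a k)
  scale r (null a≈0) = null λ k → ≈-trans (*-congˡ (a≈0 k)) (zeroʳ r)
  scale {a} r (step {b = b} d eq s) = step d (λ k → ≈-trans (*-congˡ (eq k))
    (solve 4 (λ r d x y → r :* (d :* x :+ y) := d :* (r :* x) :+ r :* y) ≈-refl r d (a k) (b k)))
    (scale r s)

  -- The operator E + r commutes with every E - d, so the same scalars still annihilate. With r = -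
  -- d this covers the sequence (E - d) b needed for sums.
  shift+scale : ∀ r → SplitRecurrent a → SplitRecurrent (λ k → a (suc k) + r * a k)
  shift+scale r (null a≈0) = null λ k →
    ≈-trans (+-cong (a≈0 (suc k)) (≈-trans (*-congˡ (a≈0 k)) (zeroʳ r))) (+-identityˡ 0#)
  shift+scale {a} r (step {b = b} d eq s) = step d (λ k → begin
    a (suc (suc k)) + r * a (suc k)
      ≈⟨ +-cong (eq (suc k)) (*-congˡ (eq k)) ⟩
    (d * a (suc k) + b (suc k)) + r * (d * a k + b k)
      ≈⟨ solve 6 (λ d r x x′ y y′ → (d :* x′ :+ y′) :+ r :* (d :* x :+ y)
           := d :* (x′ :+ r :* x) :+ (y′ :+ r :* y)) ≈-refl d r (a k) (a (suc k)) (b k) (b (suc k)) ⟩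
    d * (a (suc k) + r * a k) + (b (suc k) + r * b k) ∎)
    (shift+scale r s)

  -- The one place in this module where `- d` is cancelled against `d`; the solver calls treat `- d`
  -- as an atom of a semiring.
  x+[y-x]≈y : ∀ d x y → d * x + (y + (- d) * x) ≈ y
  x+[y-x]≈y d x y = begin
    d * x + (y + (- d) * x)
      ≈⟨ solve 3 (λ u y v → u :+ (y :+ v) := y :+ (u :+ v)) ≈-refl (d * x) y ((- d) * x) ⟩
    y + (d * x + (- d) * x) ≈⟨ +-congˡ (≈-trans (≈-sym (distribʳ x d (- d)))
                                 (≈-trans (*-congʳ (-‿inverseʳ d)) (zeroˡ x))) ⟩
    y + 0#                  ≈⟨ +-identityʳ y ⟩
    y ∎

  -- If (E − d) a = a′ then (E − d) (a + b) = a′ + (E − d) b.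
  _⊞_ : SplitRecurrent a → SplitRecurrent b → SplitRecurrent (λ k → a k + b k)
  null a≈0 ⊞ t = resp (λ k → ≈-sym (≈-trans (+-congʳ (a≈0 k)) (+-identityˡ _))) t
  _⊞_ {a} {b} (step {b = a′} d eq s) t = step d (λ k → begin
    a (suc k) + b (suc k)
      ≈⟨ +-cong (eq k) (≈-sym (x+[y-x]≈y d (b k) (b (suc k)))) ⟩
    (d * a k + a′ k) + (d * b k + (b (suc k) + (- d) * b k))
      ≈⟨ solve 5 (λ d x x′ y z → (d :* x :+ x′) :+ (d :* y :+ z)
           := d :* (x :+ y) :+ (x′ :+ z)) ≈-refl d (a k) (a′ k) (b k) _ ⟩
    d * (a k + b k) + (a′ k + (b (suc k) + (- d) * b k)) ∎)
    (s ⊞ shift+scale (- d) t)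

  -- If (E − d) a = a′ and (E − e) b = b′ then (E − d e) (a b) = d a b′ + a′ · E b.
  _⊠_ : SplitRecurrent a → SplitRecurrent b → SplitRecurrent (λ k → a k * b k)
  null a≈0 ⊠ t        = null λ k → ≈-trans (*-congʳ (a≈0 k)) (zeroˡ _)
  step _ _ _ ⊠ null b≈0 = null λ k → ≈-trans (*-congˡ (b≈0 k)) (zeroʳ _)
  _⊠_ {a} {b} s@(step {b = a′} d eqᵃ s′) t@(step {b = b′} e eqᵇ t′) = step (d * e) (λ k → begin
    a (suc k) * b (suc k)
      ≈⟨ *-congʳ (eqᵃ k) ⟩
    (d * a k + a′ k) * b (suc k)
      ≈⟨ distribʳ _ _ _ ⟩
    d * a k * b (suc k) + a′ k * b (suc k)
      ≈⟨ +-congʳ (*-congˡ (eqᵇ k)) ⟩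
    d * a k * (e * b k + b′ k) + a′ k * b (suc k)
      ≈⟨ solve 6 (λ d e x y y′ z → d :* x :* (e :* y :+ y′) :+ z
           := d :* e :* (x :* y) :+ (d :* (x :* y′) :+ z)) ≈-refl d e (a k) (b k) (b′ k) _ ⟩
    d * e * (a k * b k) + (d * (a k * b′ k) + a′ k * b (suc k)) ∎)
    (scale d (s ⊠ t′) ⊞ (s′ ⊠ shift t))

  module _ {i} {I : Set i} where

    sum : ∀ (xs : List I) {f : I → Seq} → (∀ x → SplitRecurrent (f x)) →
      SplitRecurrent (λ k → ∑[ xs ] λ x → f x k)
    sum []       s = null λ _ → ≈-refl
    sum (x ∷ xs) s = s x ⊞ sum xs s

    module _ (U : List I) (w : I → I → Carrier) (ρ : I → ℕ)
      (triangular : ∀ i j → w i j ≈ 0# ⊎ j ≡ i ⊎ ρ j < ρ i)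
      (f : I → Seq) (f-suc : ∀ i k → f i (suc k) ≈ ∑[ U ] λ j → w i j * f j k) where

      private
        go : ∀ i → Acc _<_ (ρ i) → SplitRecurrent (f i)
        go i (acc rec) =
          let d , g , s , eq = separate U in step d (λ k → ≈-trans (f-suc i k) (eq k)) s
          where
          -- Row `i` of the system is sorted by the three cases of triangularity: zero weights
          -- vanish, occurrences of `i` itself add up to the scalar `d`, and indices of smaller rank
          -- go into `g`, which is recurrent by induction. Starting from `0#` allows `i` to occur in
          -- `U` any number of times.
          separate : ∀ V → Σ[ d ∈ Carrier ] Σ[ g ∈ Seq ] (SplitRecurrent g ×
            (∀ k → ∑[ V ] (λ j → w i j * f j k) ≈ d * f i k + g k))
          separate [] = 0# , (λ _ → 0#) , null (λ _ → ≈-refl) ,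
            λ k → ≈-sym (≈-trans (+-identityʳ _) (zeroˡ _))
          separate (j ∷ V) with separate V | triangular i j
          ... | d , g , s , eq | inj₁ w≈0 = d , g , s , λ k →
            ≈-trans (+-congʳ (≈-trans (*-congʳ w≈0) (zeroˡ _))) (≈-trans (+-identityˡ _) (eq k))
          ... | d , g , s , eq | inj₂ (inj₁ refl) = w i i + d , g , s , λ k →
            ≈-trans (+-congˡ (eq k)) (solve 4 (λ w d x y → w :* x :+ (d :* x :+ y)
              := (w :+ d) :* x :+ y) ≈-refl (w i i) d (f i k) (g k))
          ... | d , g , s , eq | inj₂ (inj₂ ρj<ρi) =
            d , (λ k → w i j * f j k + g k) , scale (w i j) (go j (rec ρj<ρi)) ⊞ s , λ k →
            ≈-trans (+-congˡ (eq k)) (solve 3 (λ u v y → u :+ (v :+ y) := v :+ (u :+ y))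
              ≈-refl (w i j * f j k) (d * f i k) (g k))

      triangularSystem : ∀ i → SplitRecurrent (f i)
      triangularSystem i = go i (<-wellFounded (ρ i))

  -- Expanding ∏ᵢ (E - dᵢ) into an explicit recurrence

  ∑ᶠ : ∀ {r} → (Fin r → Carrier) → Carrier
  ∑ᶠ = F.foldr _+_ 0#

  private
    -- ∑ᵢ cᵢ E^(r-1-i) applied to a and evaluated at suc k.
    op : ∀ {r} → (Fin r → Carrier) → Seq → ℕ → Carrier
    op {r} c a k = ∑ᶠ λ i → c i * a (suc (r ℕ.+ k) ∸ suc (toℕ i))

    -- The coefficients of (q Eʳ + ∑ᵢ cᵢ E^(r-1-i)) (E − d) below the leading one.
    mul : ∀ {r} → Carrier → Carrier → (Fin r → Carrier) → Fin (suc r) → Carrier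
    mul {zero}  d q c zero    = (- d) * q
    mul {suc r} d q c zero    = c zero + (- d) * q
    mul {suc r} d q c (suc i) = mul d (c zero) (c ∘ suc) i

    -- With C the operator with coefficients `c` and b = (E - d) a, (q Eʳ + C)(E - d) a = q Eʳ⁺¹ a -
    -- q d Eʳ a + C b. The leading term is not part of `op`, which leaves the right-hand side. The
    -- induction on r hands over the top coefficient `c zero` as the new `q`.
    op-mul : ∀ {r} d q (c : Fin r → Carrier) →
      (∀ k → a (suc (suc k)) ≈ d * a (suc k) + b (suc k)) →
      ∀ k → op (mul d q c) a k ≈ q * ((- d) * a (suc (r ℕ.+ k))) + op c b k
    op-mul {a} {r = zero}  d q c eq k =
      +-congʳ (solve 3 (λ d q x → d :* q :* x := q :* (d :* x)) ≈-refl (- d) q (a (suc k)))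
    op-mul {a} {b} {r = suc r} d q c eq k = begin
      (c zero + (- d) * q) * a (suc m) + op (mul d (c zero) (c ∘ suc)) a k
        ≈⟨ +-congˡ (op-mul {a} {b} d (c zero) (c ∘ suc) eq k) ⟩
      (c zero + (- d) * q) * a (suc m) + (c zero * ((- d) * a m) + op (c ∘ suc) b k)
        ≈⟨ solve 6 (λ c d q x y z → (c :+ d :* q) :* y :+ (c :* (d :* x) :+ z)
             := q :* (d :* y) :+ (c :* (y :+ d :* x) :+ z)) ≈-refl
             (c zero) (- d) q (a m) (a (suc m)) (op (c ∘ suc) b k) ⟩
      q * ((- d) * a (suc m)) + (c zero * (a (suc m) + (- d) * a m) + op (c ∘ suc) b k)
        ≈⟨ +-congˡ (+-congʳ (*-congˡ (difference (r ℕ.+ k)))) ⟩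
      q * ((- d) * a (suc m)) + (c zero * b m + op (c ∘ suc) b k) ∎
      where
      m = suc (r ℕ.+ k)
      difference : ∀ k → a (suc (suc k)) + (- d) * a (suc k) ≈ b (suc k)
      difference k = begin
        a (suc (suc k)) + (- d) * a (suc k)
          ≈⟨ +-congʳ (eq k) ⟩
        (d * a (suc k) + b (suc k)) + (- d) * a (suc k)
          ≈⟨ +-assoc _ _ _ ⟩
        d * a (suc k) + (b (suc k) + (- d) * a (suc k))
          ≈⟨ x+[y-x]≈y d (a (suc k)) (b (suc k)) ⟩
        b (suc k) ∎

    recurrence : SplitRecurrent b → ∀ a → (∀ k → a (suc k) ≈ b k) →
      Σ[ r ∈ ℕ ] r ≥ 1 × (Σ[ c ∈ (Fin r → Carrier) ] ∀ k → a (suc (r ℕ.+ k)) + op c a k ≈ 0#)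
    -- The order must be at least 1, so the empty product of operators is padded to order 1 with
    -- coefficient 0.
    recurrence (null b≈0) a a≈b = 1 , ℕ.≤-refl , (λ _ → 0#) , λ k →
      ≈-trans (+-cong (≈-trans (a≈b _) (b≈0 _)) (≈-trans (+-identityʳ _) (zeroˡ _))) (+-identityˡ 0#)
    recurrence (step {b = b′} d eq s) a a≈b =
      let r , _ , c , rec = recurrence s a′ (λ _ → ≈-refl) in
      suc r , s≤s z≤n , mul d 1# c , λ k → begin
        a (suc (suc (r ℕ.+ k))) + op (mul d 1# c) a k
          ≈⟨ +-cong (eq′ (r ℕ.+ k)) (op-mul {a} {a′} d 1# c eq′ k) ⟩
        (d * a (suc (r ℕ.+ k)) + a′ (suc (r ℕ.+ k))) + (1# * ((- d) * a (suc (r ℕ.+ k))) + op c a′ k)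
          ≈⟨ +-congˡ (+-congʳ (*-identityˡ _)) ⟩
        (d * a (suc (r ℕ.+ k)) + a′ (suc (r ℕ.+ k))) + ((- d) * a (suc (r ℕ.+ k)) + op c a′ k)
          ≈⟨ solve 4 (λ u y v z → (u :+ y) :+ (v :+ z) := (u :+ (y :+ v)) :+ z) ≈-refl _ _ _ _ ⟩
        (d * a (suc (r ℕ.+ k)) + (a′ (suc (r ℕ.+ k)) + (- d) * a (suc (r ℕ.+ k)))) + op c a′ k
          ≈⟨ +-congʳ (x+[y-x]≈y d _ _) ⟩
        a′ (suc (r ℕ.+ k)) + op c a′ k
          ≈⟨ rec k ⟩
        0# ∎
      where
      -- `a′` is (E - d) a, indexed from 1 like `a`. Its value at 0 is a dummy: `op c a′ k` reads
      -- the indices r + k - i with i < r, all at least 1.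
      a′ : Seq
      a′ zero    = 0#
      a′ (suc k) = b′ k
      eq′ : ∀ k → a (suc (suc k)) ≈ d * a (suc k) + a′ (suc k)
      eq′ k = ≈-trans (a≈b (suc k)) (≈-trans (eq k) (+-congʳ (*-congˡ (≈-sym (a≈b k)))))

  splitRecurrent⇒recurrence : SplitRecurrent (a ∘ suc) →
    Σ[ r ∈ ℕ ] r ≥ 1 × (Σ[ c ∈ (Fin r → Carrier) ]
      (∀ k → k ≥ suc r → a k + ∑ᶠ (λ i → c i * a (k ∸ suc (toℕ i))) ≈ 0#))
  splitRecurrent⇒recurrence {a} s =
    let r , r≥1 , c , rec = recurrence s a (λ _ → ≈-refl) in
    r , r≥1 , c , λ k k>r →
      subst (λ k → a k + ∑ᶠ (λ i → c i * a (k ∸ suc (toℕ i))) ≈ 0#) (ℕ.m+[n∸m]≡n k>r) (rec (k ∸ suc r))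

-- Peeling off the first column of a filling

-- The relation between an entry and a lower one in the same column; a ≡ 0
-- means that there is no cell to compare with.
infix 4 _≽_ _≽?_
_≽_ : ℕ → ℕ → Set
a ≽ b = a ≡ 0 ⊎ b ≤ a

_≽?_ : ∀ a b → Dec (a ≽ b)
a ≽? b = (a ℕ.≟ 0) ⊎-dec (b ℕ.≤? a)

largestPart-pred : ∀ ps → largestPart (map pred ps) ≡ pred (largestPart ps)
largestPart-pred []       = refl
largestPart-pred (p ∷ ps) = trans (cong (pred p ℕ.⊔_) (largestPart-pred ps))
  (sym (ℕ.mono-≤-distrib-⊔ ℕ.pred-mono-≤ p (largestPart ps)))

module _ {n : ℕ} where

  Row : ℕ → Set
  Row = Vec (Fin n)

  -- Cells are numbered 1 + toℕ v as in the paper; 0 means that there is no cell.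
  rowCell : ∀ {m} → Row m → ℕ → ℕ
  rowCell []      j       = 0
  rowCell (v ∷ r) zero    = suc (toℕ v)
  rowCell (v ∷ r) (suc j) = rowCell r j

  cell : ∀ {ps} → Filling n ps → ℕ → ℕ → ℕ
  cell []      i       j = 0
  cell (r ∷ T) zero    j = rowCell r j
  cell (r ∷ T) (suc i) j = cell T i j

  dropFirst : ∀ {m} → Row m → Row (pred m)
  dropFirst []      = []
  dropFirst (v ∷ r) = r

  -- An empty row contributes an entry 0, so columns of different heights have equal length and can
  -- be compared componentwise.
  firstColumn : ∀ {ps} → Filling n ps → List ℕ
  firstColumn []      = []
  firstColumn (r ∷ T) = rowCell r 0 ∷ firstColumn T

  otherColumns : ∀ {ps} → Filling n ps → Filling n (map pred ps)
  otherColumns []      = []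
  otherColumns (r ∷ T) = dropFirst r ∷ otherColumns T

  rowCell-dropFirst : ∀ {m} (r : Row m) j → rowCell (dropFirst r) j ≡ rowCell r (suc j)
  rowCell-dropFirst []      j = refl
  rowCell-dropFirst (v ∷ r) j = refl

  cell-otherColumns : ∀ {ps} (T : Filling n ps) i j → cell (otherColumns T) i j ≡ cell T i (suc j)
  cell-otherColumns []      i       j = refl
  cell-otherColumns (r ∷ T) zero    j = rowCell-dropFirst r j
  cell-otherColumns (r ∷ T) (suc i) j = cell-otherColumns T i j

  rowCell-lookup : ∀ {m} (r : Row m) j → rowCell r (toℕ j) ≡ suc (toℕ (Vec.lookup r j))
  rowCell-lookup (v ∷ r) zero    = refl
  rowCell-lookup (v ∷ r) (suc j) = rowCell-lookup r j

  cell-entry : ∀ {ps} (T : Filling n ps) i j → cell T (toℕ i) (toℕ j) ≡ suc (toℕ (entry T i j))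
  cell-entry (r ∷ T) zero    j = rowCell-lookup r j
  cell-entry (r ∷ T) (suc i) j = cell-entry T i j

  rowCell⁻ : ∀ {m} (r : Row m) j → rowCell r j ≡ 0 ⊎ Σ[ j′ ∈ Fin m ] toℕ j′ ≡ j
  rowCell⁻ []      j       = inj₁ refl
  rowCell⁻ (v ∷ r) zero    = inj₂ (zero , refl)
  rowCell⁻ (v ∷ r) (suc j) with rowCell⁻ r j
  ... | inj₁ ≡0          = inj₁ ≡0
  ... | inj₂ (j′ , refl) = inj₂ (suc j′ , refl)

  cell⁻ : ∀ {ps} (T : Filling n ps) i j → cell T i j ≡ 0 ⊎
    (Σ[ i′ ∈ Fin (length ps) ] Σ[ j′ ∈ Fin (lookup ps i′) ] (toℕ i′ ≡ i × toℕ j′ ≡ j))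
  cell⁻ []      i       j = inj₁ refl
  cell⁻ (r ∷ T) zero    j with rowCell⁻ r j
  ... | inj₁ ≡0        = inj₁ ≡0
  ... | inj₂ (j′ , eq) = inj₂ (zero , j′ , refl , eq)
  cell⁻ (r ∷ T) (suc i) j with cell⁻ T i j
  ... | inj₁ ≡0                   = inj₁ ≡0
  ... | inj₂ (i′ , j′ , refl , eq) = inj₂ (suc i′ , j′ , refl , eq)

  -- Here `cell` is total, so removing a column is just a shift of `j`. In a row the 0 of an absent
  -- cell is harmless, as absent cells come last. In a column the upper cell may be absent while the
  -- lower one is present, since `ps` is an arbitrary list; hence the escape clause.
  RowCells ColumnCells : ∀ {ps} → Filling n ps → Set
  RowCells    T = ∀ i j → cell T i (suc j) ≤ cell T i j
  ColumnCells T = ∀ i i′ j → i < i′ → cell T i j ≡ 0 ⊎ cell T i′ j ≤ cell T i j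

  rowCells⇒decreasing : ∀ {ps} {T : Filling n ps} → RowCells T →
    ∀ i {j j′} → j ℕ.≤′ j′ → cell T i j′ ≤ cell T i j
  rowCells⇒decreasing R i ℕ.≤′-refl        = ℕ.≤-refl
  rowCells⇒decreasing {T = T} R i (ℕ.≤′-step j≤j′) = ℕ.≤-trans (R i _) (rowCells⇒decreasing {T = T} R i j≤j′)

  isRPP⇒cells : ∀ {ps} {T : Filling n ps} → IsRPP T → RowCells T × ColumnCells T
  isRPP⇒cells {ps} {T} (rows , columns) = rowCells , columnCells
    where
    rowCells : RowCells T
    rowCells i j with cell⁻ T i (suc j)
    ... | inj₁ ≡0 = ℕ.≤-trans (ℕ.≤-reflexive ≡0) z≤n
    ... | inj₂ (i₁ , j₂ , refl , eq) = begin
        cell T (toℕ i₁) (suc j)     ≡⟨ cong (cell T (toℕ i₁)) eq ⟨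
        cell T (toℕ i₁) (toℕ j₂)    ≡⟨ cell-entry T i₁ j₂ ⟩
        suc (toℕ (entry T i₁ j₂))   ≤⟨ s≤s (rows i₁ j₁ j₂ j₁≤j₂) ⟩
        suc (toℕ (entry T i₁ j₁))   ≡⟨ cell-entry T i₁ j₁ ⟨
        cell T (toℕ i₁) (toℕ j₁)    ≡⟨ cong (cell T (toℕ i₁)) (Fin.toℕ-fromℕ< j<p) ⟩
        cell T (toℕ i₁) j           ∎
      where
      open ℕ.≤-Reasoning
      j<p : j < lookup ps i₁
      j<p = ℕ.<⇒≤ (subst (_< lookup ps i₁) eq (Fin.toℕ<n j₂))
      j₁ : Fin (lookup ps i₁)
      j₁ = Fin.fromℕ< j<p
      j₁≤j₂ : j₁ Fin.≤ j₂
      j₁≤j₂ rewrite Fin.toℕ-fromℕ< j<p | eq = ℕ.n≤1+n j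

    columnCells : ColumnCells T
    columnCells i i′ j i<i′ with cell⁻ T i j | cell⁻ T i′ j
    ... | inj₁ ≡0 | _       = inj₁ ≡0
    ... | _       | inj₁ ≡0 = inj₂ (ℕ.≤-trans (ℕ.≤-reflexive ≡0) z≤n)
    ... | inj₂ (i₁ , j₁ , refl , refl) | inj₂ (i₂ , j₂ , refl , eq) = inj₂ (begin
        cell T (toℕ i₂) (toℕ j₁)  ≡⟨ cong (cell T (toℕ i₂)) eq ⟨
        cell T (toℕ i₂) (toℕ j₂)  ≡⟨ cell-entry T i₂ j₂ ⟩
        suc (toℕ (entry T i₂ j₂)) ≤⟨ s≤s (columns i₁ i₂ j₁ j₂ (ℕ.<⇒≤ i<i′) (sym eq)) ⟩
        suc (toℕ (entry T i₁ j₁)) ≡⟨ cell-entry T i₁ j₁ ⟨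
        cell T (toℕ i₁) (toℕ j₁)  ∎)
      where open ℕ.≤-Reasoning

  cells⇒isRPP : ∀ {ps} {T : Filling n ps} → RowCells T → ColumnCells T → IsRPP T
  cells⇒isRPP {T = T} R C = rows , columns
    where
    rows : RowsDecreasing T
    rows i j j′ j≤j′ = ℕ.s≤s⁻¹ (≡.subst₂ _≤_ (cell-entry T i j′) (cell-entry T i j)
      (rowCells⇒decreasing {T = T} R (toℕ i) (ℕ.≤⇒≤′ j≤j′)))

    columns : ColumnsDecreasing T
    columns i i′ j j′ i≤i′ eq with ℕ.m≤n⇒m<n∨m≡n i≤i′
    ... | inj₂ i≡i′ with refl ← Fin.toℕ-injective i≡i′ with refl ← Fin.toℕ-injective eq = ℕ.≤-refl
    ... | inj₁ i<i′ with C (toℕ i) (toℕ i′) (toℕ j) i<i′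
    ...   | inj₁ ≡0 = contradiction (trans (sym (cell-entry T i j)) ≡0) λ ()
    ...   | inj₂ c≤ = ℕ.s≤s⁻¹ (≡.subst₂ _≤_
      (trans (cong (cell T (toℕ i′)) eq) (cell-entry T i′ j′)) (cell-entry T i j) c≤)

  All-firstColumn⁺ : ∀ {ps} (T : Filling n ps) {Q : ℕ → Set} → (∀ i → Q (cell T i 0)) → All Q (firstColumn T)
  All-firstColumn⁺ []      q = []
  All-firstColumn⁺ (r ∷ T) q = q zero ∷ All-firstColumn⁺ T (q ∘ suc)

  All-firstColumn⁻ : ∀ {ps} (T : Filling n ps) {Q : ℕ → Set} → Q 0 → All Q (firstColumn T) → ∀ i → Q (cell T i 0)
  All-firstColumn⁻ []      q₀ qs       i       = q₀
  All-firstColumn⁻ (r ∷ T) q₀ (q ∷ qs) zero    = q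
  All-firstColumn⁻ (r ∷ T) q₀ (q ∷ qs) (suc i) = All-firstColumn⁻ T q₀ qs i

  AllPairs-firstColumn⁺ : ∀ {ps} (T : Filling n ps) →
    (∀ i i′ → i < i′ → cell T i 0 ≽ cell T i′ 0) → AllPairs _≽_ (firstColumn T)
  AllPairs-firstColumn⁺ []      C = []
  AllPairs-firstColumn⁺ (r ∷ T) C =
    All-firstColumn⁺ T (λ i → C zero (suc i) (s≤s z≤n)) ∷
    AllPairs-firstColumn⁺ T (λ i i′ i<i′ → C (suc i) (suc i′) (s≤s i<i′))

  AllPairs-firstColumn⁻ : ∀ {ps} (T : Filling n ps) → AllPairs _≽_ (firstColumn T) →
    ∀ i i′ → i < i′ → cell T i 0 ≽ cell T i′ 0
  AllPairs-firstColumn⁻ []      C        i       i′       _          = inj₁ refl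
  AllPairs-firstColumn⁻ (r ∷ T) (c ∷ C) zero    (suc i′) _          =
    All-firstColumn⁻ T (inj₂ z≤n) c i′
  AllPairs-firstColumn⁻ (r ∷ T) (c ∷ C) (suc i) (suc i′) (s≤s i<i′) =
    AllPairs-firstColumn⁻ T C i i′ i<i′

  Pointwise-firstColumn⁺ : ∀ {ps} (T : Filling n ps) → (∀ i → cell T i 1 ≤ cell T i 0) →
    Pointwise _≤_ (firstColumn (otherColumns T)) (firstColumn T)
  Pointwise-firstColumn⁺ []      R = []
  Pointwise-firstColumn⁺ (r ∷ T) R =
    subst (_≤ rowCell r 0) (sym (rowCell-dropFirst r 0)) (R 0) ∷ Pointwise-firstColumn⁺ T (R ∘ suc)

  Pointwise-firstColumn⁻ : ∀ {ps} (T : Filling n ps) →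
    Pointwise _≤_ (firstColumn (otherColumns T)) (firstColumn T) → ∀ i → cell T i 1 ≤ cell T i 0
  Pointwise-firstColumn⁻ []      []       i       = z≤n
  Pointwise-firstColumn⁻ (r ∷ T) (c≤ ∷ cs≤) zero    = subst (_≤ rowCell r 0) (rowCell-dropFirst r 0) c≤
  Pointwise-firstColumn⁻ (r ∷ T) (c≤ ∷ cs≤) (suc i) = Pointwise-firstColumn⁻ T cs≤ i

  -- The column condition concerns each column separately and the row condition only adjacent
  -- columns. So the first column interacts with the rest solely through the comparison with the
  -- next column, which is what makes a transfer matrix possible.
  isRPP-firstColumn : ∀ {ps} (T : Filling n ps) → IsRPP T ⇔
    (AllPairs _≽_ (firstColumn T) × IsRPP (otherColumns T) ×
     Pointwise _≤_ (firstColumn (otherColumns T)) (firstColumn T))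
  isRPP-firstColumn T = mk⇔ to from
    where
    T′ = otherColumns T

    to : IsRPP T → _
    to rpp = let R , C = isRPP⇒cells {T = T} rpp in
      AllPairs-firstColumn⁺ T (λ i i′ → C i i′ 0) ,
      cells⇒isRPP {T = T′}
        (λ i j → ≡.subst₂ _≤_ (sym (cell-otherColumns T i (suc j))) (sym (cell-otherColumns T i j)) (R i (suc j)))
        (λ i i′ j i<i′ → ≡.subst₂ _≽_ (sym (cell-otherColumns T i j)) (sym (cell-otherColumns T i′ j))
          (C i i′ (suc j) i<i′)) ,
      Pointwise-firstColumn⁺ T (λ i → R i 0)

    from : _ → IsRPP T
    from (c , rpp , cs≤) = let R , C = isRPP⇒cells {T = T′} rpp in cells⇒isRPP {T = T}
      (λ where
        i zero    → Pointwise-firstColumn⁻ T cs≤ i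
        i (suc j) → ≡.subst₂ _≤_ (cell-otherColumns T i (suc j)) (cell-otherColumns T i j) (R i j))
      (λ where
        i i′ zero    → AllPairs-firstColumn⁻ T c i i′
        i i′ (suc j) → ≡.subst₂ _≽_ (cell-otherColumns T i j) (cell-otherColumns T i′ j) ∘ C i i′ j)

  -- Evaluation of a filling, one column at a time

  content : List ℕ → Exponent n
  content u = Vec.tabulate λ v → if does (suc (toℕ v) ∈? u) then 1 else 0

  appearsInColumn⇔cell : ∀ {ps} (T : Filling n ps) v j →
    AppearsInColumn T v j ⇔ (∃[ i ] cell T i j ≡ suc (toℕ v))
  appearsInColumn⇔cell T v j = mk⇔
    (λ { (i , j , refl , eq) → toℕ i , trans (cell-entry T i j) (cong (suc ∘ toℕ) eq) })
    from
    where
    from : ∃[ i ] cell T i j ≡ suc (toℕ v) → AppearsInColumn T v j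
    from (i , eq) with cell⁻ T i j
    ... | inj₁ ≡0                      = contradiction (trans (sym ≡0) eq) λ ()
    ... | inj₂ (i₁ , j₁ , refl , refl) =
      i₁ , j₁ , refl , Fin.toℕ-injective (ℕ.suc-injective (trans (sym (cell-entry T i₁ j₁)) eq))

  ∈-firstColumn⁺ : ∀ {ps} (T : Filling n ps) {v} → ∃[ i ] cell T i 0 ≡ suc v → suc v ∈ firstColumn T
  ∈-firstColumn⁺ (r ∷ T) (zero  , eq) = here (sym eq)
  ∈-firstColumn⁺ (r ∷ T) (suc i , eq) = there (∈-firstColumn⁺ T (i , eq))

  ∈-firstColumn⁻ : ∀ {ps} (T : Filling n ps) {v} → suc v ∈ firstColumn T → ∃[ i ] cell T i 0 ≡ suc v
  ∈-firstColumn⁻ (r ∷ T) (here eq) = zero , sym eq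
  ∈-firstColumn⁻ (r ∷ T) (there ∈) = let i , eq = ∈-firstColumn⁻ T ∈ in suc i , eq

  appearsInColumn-zero : ∀ {ps} (T : Filling n ps) v →
    AppearsInColumn T v 0 ⇔ suc (toℕ v) ∈ firstColumn T
  appearsInColumn-zero T v = let open Equivalence (appearsInColumn⇔cell T v 0) in
    mk⇔ (∈-firstColumn⁺ T ∘ to) (from ∘ ∈-firstColumn⁻ T)

  appearsInColumn-suc : ∀ {ps} (T : Filling n ps) v j →
    AppearsInColumn T v (suc j) ⇔ AppearsInColumn (otherColumns T) v j
  appearsInColumn-suc T v j = mk⇔
    (λ app → let i , eq = to app in from′ (i , trans (cell-otherColumns T i j) eq))
    (λ app → let i , eq = to′ app in from (i , trans (sym (cell-otherColumns T i j)) eq))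
    where
    open Equivalence (appearsInColumn⇔cell T v (suc j))
    open Equivalence (appearsInColumn⇔cell (otherColumns T) v j) renaming (to to to′; from to from′)

  appearsInColumn⇒<largestPart : ∀ {ps} (T : Filling n ps) {v j} → AppearsInColumn T v j → j < largestPart ps
  appearsInColumn⇒<largestPart (r ∷ T) (zero  , j , refl , _) = ℕ.m≤n⇒m≤n⊔o _ (Fin.toℕ<n j)
  appearsInColumn⇒<largestPart {p ∷ _} (r ∷ T) (suc i , j , eq , eq′) =
    ℕ.m≤n⇒m≤o⊔n p (appearsInColumn⇒<largestPart T (i , j , eq , eq′))

count-shift : ∀ {P Q : ℕ → Set} (P? : Decidable P) (Q? : Decidable Q) →
  (∀ j → P (suc j) ⇔ Q j) → ∀ (f : ℕ → ℕ) L →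
  length (filter P? (applyUpTo (suc ∘ f) L)) ≡ length (filter Q? (applyUpTo f L))
count-shift P? Q? P⇔Q f zero    = refl
count-shift P? Q? P⇔Q f (suc L) with P? (suc (f 0)) | Q? (f 0) | count-shift P? Q? P⇔Q (f ∘ suc) L
... | yes _ | yes _ | eq = cong suc eq
... | no _  | no _  | eq = eq
... | yes p | no ¬q | _  = contradiction (Equivalence.to (P⇔Q _) p) ¬q
... | no ¬p | yes q | _  = contradiction (Equivalence.from (P⇔Q _) q) ¬p

zipWith-tabulate : ∀ {A B C : Set} (_∙_ : A → B → C) {m} (f : Fin m → A) (g : Fin m → B) →
  Vec.zipWith _∙_ (Vec.tabulate f) (Vec.tabulate g) ≡ Vec.tabulate (λ i → f i ∙ g i)
zipWith-tabulate _∙_ {zero}  f g = refl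
zipWith-tabulate _∙_ {suc m} f g = cong (_ ∷_) (zipWith-tabulate _∙_ (f ∘ suc) (g ∘ suc))

module _ {n : ℕ} where

  -- The number of columns is a variable `L` so that it can be split into cases. If it is 0, no
  -- value appears anywhere; otherwise column 0 is counted on its own and the later columns are
  -- those of `otherColumns T`, shifted by one.
  count-firstColumn : ∀ {ps} (T : Filling n ps) v L → L ≡ largestPart ps →
    length (filter (appearsInColumn? T v) (List.upTo L)) ≡
    (if does (suc (toℕ v) ∈? firstColumn T) then 1 else 0) ℕ.+
    length (filter (appearsInColumn? (otherColumns T) v) (List.upTo (pred L)))
  count-firstColumn T v zero eq with suc (toℕ v) ∈? firstColumn T
  ... | no _  = refl
  ... | yes ∈ = contradiction (subst (0 <_) (sym eq)
    (appearsInColumn⇒<largestPart T (Equivalence.from (appearsInColumn-zero T v) ∈))) λ ()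
  count-firstColumn T v (suc L) _
    with appearsInColumn? T v 0 | suc (toℕ v) ∈? firstColumn T
       | count-shift (appearsInColumn? T v) (appearsInColumn? (otherColumns T) v) (appearsInColumn-suc T v) id L
  ... | yes _ | yes _ | eq = cong suc eq
  ... | no _  | no _  | eq = eq
  ... | yes a | no ∉  | _  = contradiction (Equivalence.to (appearsInColumn-zero T v) a) ∉
  ... | no ¬a | yes ∈ | _  = contradiction (Equivalence.from (appearsInColumn-zero T v) ∈) ¬a

  -- Gives the multiplicativity of the weight over columns: `content` counts a value once per
  -- column, however often it is repeated there, exactly as `ev` does.
  ev-firstColumn : ∀ {ps} (T : Filling n ps) →
    ev T ≡ Vec.zipWith ℕ._+_ (content (firstColumn T)) (ev (otherColumns T))
  ev-firstColumn {ps} T = trans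
    (Vec.tabulate-cong λ v → trans (count-firstColumn T v _ refl)
      (cong (λ L → (if does (suc (toℕ v) ∈? firstColumn T) then 1 else 0) ℕ.+
                  length (filter (appearsInColumn? (otherColumns T) v) (List.upTo L)))
        (sym (largestPart-pred ps))))
    (sym (zipWith-tabulate ℕ._+_ _ _))

  headCells : ℕ → List ℕ
  headCells zero    = 0 ∷ []
  headCells (suc p) = map (suc ∘ toℕ) (allFin n)

  -- All first columns of fillings of shape ps, with 0 for the absent cells.
  firstColumns : List ℕ → List (List ℕ)
  firstColumns []       = [] ∷ []
  firstColumns (p ∷ ps) = cartesianProductWith _∷_ (headCells p) (firstColumns ps)

  -- `headCells` sees only whether a part is zero. Shapes with the same empty rows therefore share
  -- one set of states for the transfer matrix.
  firstColumns-pattern : ∀ {ps qs} → map headCells ps ≡ map headCells qs → firstColumns ps ≡ firstColumns qs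
  firstColumns-pattern {[]}     {[]}     eq = refl
  firstColumns-pattern {p ∷ ps} {q ∷ qs} eq =
    cong₂ (cartesianProductWith _∷_) (List.∷-injectiveˡ eq) (firstColumns-pattern (List.∷-injectiveʳ eq))

  -- Makes the column with all entries `n` a vacuous bound, which later removes the boundary
  -- condition from the generating function.
  firstColumn-bound : ∀ {ps} (T : Filling n ps) →
    Pointwise _≤_ (firstColumn T) (replicate (length ps) n)
  firstColumn-bound []            = []
  firstColumn-bound ([] ∷ T)      = z≤n ∷ firstColumn-bound T
  firstColumn-bound ((v ∷ r) ∷ T) = Fin.toℕ<n v ∷ firstColumn-bound T

-- Componentwise order on columns

_⊑?_ : ∀ (u s : List ℕ) → Dec (Pointwise _≤_ u s)
_⊑?_ = Pointwise.decidable ℕ._≤?_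

-- One strict inequality among the components lowers the total, so the sum of the entries is a rank
-- for which the transfer matrix is triangular.
⊑⇒≡⊎< : ∀ {u s} → Pointwise _≤_ u s → u ≡ s ⊎ ℕ.sum u < ℕ.sum s
⊑⇒≡⊎< [] = inj₁ refl
⊑⇒≡⊎< (a≤b ∷ u⊑s) with ℕ.m≤n⇒m<n∨m≡n a≤b | ⊑⇒≡⊎< u⊑s
... | inj₂ refl | inj₁ refl = inj₁ refl
... | inj₂ refl | inj₂ u<s  = inj₂ (ℕ.+-monoʳ-< _ u<s)
... | inj₁ a<b  | inj₁ refl = inj₂ (ℕ.+-monoˡ-< _ a<b)
... | inj₁ a<b  | inj₂ u<s  = inj₂ (ℕ.+-mono-< a<b u<s)

-- Generating functions of fillings and transfer matrices

module GeneratingFunction {c ℓ} (R : CommutativeRing c ℓ) {n : ℕ}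
  (x : Exponent n → CommutativeRing.Carrier R)
  (x-homo : ∀ e f → CommutativeRing._≈_ R (x (Vec.zipWith ℕ._+_ e f)) (CommutativeRing._*_ R (x e) (x f)))
  where

  open CommutativeRing R hiding (zero)
    renaming (refl to ≈-refl; sym to ≈-sym; trans to ≈-trans; reflexive to ≈-reflexive)
  open ListSum R
  open Recurrence R
  open import Relation.Binary.Reasoning.Setoid setoid

  ∑-rows : ∀ m (f : ℕ → Vec (Fin n) (pred m) → Carrier) →
    ∑[ allRows n m ] (λ r → f (rowCell r 0) (dropFirst r)) ≈
    ∑[ headCells {n} m ] λ a → ∑[ allRows n (pred m) ] f a
  ∑-rows zero    f = ≈-sym (+-identityʳ _)
  ∑-rows (suc m) f = ≈-trans (∑-× _∷_ (allFin n) (allRows n m) _)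
    (≈-reflexive (sym (∑-map (suc ∘ toℕ) (allFin n) _)))

  -- A filling amounts to an independent choice of first column and of remaining columns. By
  -- induction on the rows: each row splits into its leading cell and its tail, and the sums over
  -- tails are moved past those over first columns.
  ∑-fillings : ∀ ps (f : List ℕ → Filling n (map pred ps) → Carrier) →
    ∑[ allFillings n ps ] (λ T → f (firstColumn T) (otherColumns T)) ≈
    ∑[ firstColumns {n} ps ] λ u → ∑[ allFillings n (map pred ps) ] f u
  ∑-fillings []       f = ≈-sym (+-identityʳ _)
  ∑-fillings (p ∷ ps) f = begin
    ∑[ allFillings n (p ∷ ps) ] (λ T → f (firstColumn T) (otherColumns T))
      ≈⟨ ∑-× _∷_ (allRows n p) (allFillings n ps) _ ⟩
    ∑[ allRows n p ] (λ r → ∑[ allFillings n ps ] λ T →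
      f (rowCell r 0 ∷ firstColumn T) (dropFirst r ∷ otherColumns T))
      ≈⟨ ∑-cong (allRows n p) (λ r →
           ∑-fillings ps (λ u T → f (rowCell r 0 ∷ u) (dropFirst r ∷ T))) ⟩
    ∑[ allRows n p ] (λ r → ∑[ firstColumns ps ] λ u → ∑[ allFillings n (map pred ps) ] λ T →
      f (rowCell r 0 ∷ u) (dropFirst r ∷ T))
      ≈⟨ ∑-rows p (λ a r → ∑[ firstColumns ps ] λ u → ∑[ allFillings n (map pred ps) ] λ T →
           f (a ∷ u) (r ∷ T)) ⟩
    ∑[ headCells p ] (λ a → ∑[ allRows n (pred p) ] λ r → ∑[ firstColumns ps ] λ u →
      ∑[ allFillings n (map pred ps) ] λ T → f (a ∷ u) (r ∷ T))
      ≈⟨ ∑-cong (headCells p) (λ a → ∑-swap (allRows n (pred p)) (firstColumns ps) _) ⟩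
    ∑[ headCells p ] (λ a → ∑[ firstColumns ps ] λ u → ∑[ allRows n (pred p) ] λ r →
      ∑[ allFillings n (map pred ps) ] λ T → f (a ∷ u) (r ∷ T))
      ≈⟨ ∑-cong (headCells p) (λ a → ∑-cong (firstColumns ps) λ u →
           ∑-× _∷_ (allRows n (pred p)) (allFillings n (map pred ps)) (f (a ∷ u))) ⟨
    ∑[ headCells p ] (λ a → ∑[ firstColumns ps ] λ u →
      ∑[ allFillings n (map pred (p ∷ ps)) ] f (a ∷ u))
      ≈⟨ ∑-× _∷_ (headCells p) (firstColumns ps) _ ⟨
    ∑[ firstColumns (p ∷ ps) ] (λ u → ∑[ allFillings n (map pred (p ∷ ps)) ] f u) ∎

  indicator : ∀ {P : Set} → Dec P → Carrier → Carrier
  indicator P? r = if does P? then r else 0#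

  indicator-≈0 : ∀ {P : Set} (P? : Dec P) r → indicator P? r ≈ 0# ⊎ P
  indicator-≈0 (yes p) r = inj₂ p
  indicator-≈0 (no _)  r = inj₁ ≈-refl

  indicator-* : ∀ {P Q S : Set} (P? : Dec P) (Q? : Dec Q) (S? : Dec S) → P ⇔ (Q × S) →
    ∀ {r q s} → r ≈ q * s → indicator P? r ≈ indicator Q? q * indicator S? s
  indicator-* (yes _) (yes _) (yes _) _     r≈qs = r≈qs
  indicator-* (no _)  (no _)  _       _     _    = ≈-sym (zeroˡ _)
  indicator-* (no _)  (yes _) (no _)  _     _    = ≈-sym (zeroʳ _)
  indicator-* (no ¬p) (yes q) (yes s) P⇔Q×S _    = contradiction (Equivalence.from P⇔Q×S (q , s)) ¬p
  indicator-* (yes p) (no ¬q) _       P⇔Q×S _    = contradiction (proj₁ (Equivalence.to P⇔Q×S p)) ¬q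
  indicator-* (yes p) (yes _) (no ¬s) P⇔Q×S _    = contradiction (proj₂ (Equivalence.to P⇔Q×S p)) ¬s

  -- The list `s` acts as a column standing immediately to the left of `T`; the sums `g≤ s` built
  -- from this are the states of the transfer-matrix recursion.
  isRPPBelow? : ∀ s {ps} (T : Filling n ps) → Dec (IsRPP T × Pointwise _≤_ (firstColumn T) s)
  isRPPBelow? s T = isRPP? T ×-dec (firstColumn T ⊑? s)

  term : ∀ s {ps} → Filling n ps → Carrier
  term s T = indicator (isRPPBelow? s T) (x (ev T))

  g≤ : List ℕ → List ℕ → Carrier
  g≤ s ps = ∑[ allFillings n ps ] term s

  isColumnBelow? : ∀ s u → Dec (AllPairs _≽_ u × Pointwise _≤_ u s)
  isColumnBelow? s u = AllPairs.allPairs? _≽?_ u ×-dec (u ⊑? s)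

  -- The matrix entry at (`s` , `u`): column `u` may follow `s`, and the weight charged is that of
  -- the new column `u`.
  transfer : List ℕ → List ℕ → Carrier
  transfer s u = indicator (isColumnBelow? s u) (x (content u))

  transfer-triangular : ∀ s u → transfer s u ≈ 0# ⊎ u ≡ s ⊎ ℕ.sum u < ℕ.sum s
  transfer-triangular s u with indicator-≈0 (isColumnBelow? s u) (x (content u))
  ... | inj₁ ≈0         = inj₁ ≈0
  ... | inj₂ (_ , u⊑s) = inj₂ (⊑⇒≡⊎< u⊑s)

  -- The condition factors by `isRPP-firstColumn` and the weight by `ev-firstColumn`; the removed
  -- column becomes the bound for what remains.
  term-firstColumn : ∀ s {ps} (T : Filling n ps) →
    term s T ≈ transfer s (firstColumn T) * term (firstColumn T) (otherColumns T)
  term-firstColumn s T = indicator-*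
    (isRPPBelow? s T) (isColumnBelow? s (firstColumn T)) (isRPPBelow? (firstColumn T) (otherColumns T))
    (mk⇔ (λ (rpp , u⊑s) → let column , rest = to rpp in (column , u⊑s) , rest)
         (λ ((column , u⊑s) , rest) → from (column , rest) , u⊑s))
    (≈-trans (≈-reflexive (cong x (ev-firstColumn T)))
             (x-homo (content (firstColumn T)) (ev (otherColumns T))))
    where open Equivalence (isRPP-firstColumn T)

  g≤-firstColumn : ∀ s ps →
    g≤ s ps ≈ ∑[ firstColumns ps ] λ u → transfer s u * g≤ u (map pred ps)
  g≤-firstColumn s ps = begin
    ∑[ allFillings n ps ] term s
      ≈⟨ ∑-cong (allFillings n ps) (term-firstColumn s) ⟩
    ∑[ allFillings n ps ] (λ T → transfer s (firstColumn T) * term (firstColumn T) (otherColumns T))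
      ≈⟨ ∑-fillings ps (λ u T → transfer s u * term u T) ⟩
    ∑[ firstColumns ps ] (λ u → ∑[ allFillings n (map pred ps) ] λ T → transfer s u * term u T)
      ≈⟨ ∑-cong (firstColumns ps) (λ u → ≈-sym (*-∑ (allFillings n (map pred ps)) (transfer s u) (term u))) ⟩
    ∑[ firstColumns ps ] (λ u → transfer s u * g≤ u (map pred ps)) ∎

  -- The entry at (s , t) of the (k+1)-st power of the transfer matrix.
  power : List ℕ → List ℕ → List ℕ → ℕ → Carrier
  power ps t s zero    = transfer s t
  power ps t s (suc k) = ∑[ firstColumns {n} ps ] λ u → transfer s u * power ps t u k

  -- For fixed `t` the entries, indexed by `s`, satisfy a linear system in k whose matrix is
  -- `transfer`, triangular for the sum of entries.
  power-splitRecurrent : ∀ ps t s → SplitRecurrent (power ps t s)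
  power-splitRecurrent ps t = triangularSystem (firstColumns {n} ps) transfer ℕ.sum
    transfer-triangular (power ps t) (λ _ _ → ≈-refl)

  -- A row of length K·p after K ∸ j of the K columns coming from the first
  -- column of the unscaled diagram have been removed.
  partlyPeeled : ℕ → ℕ → ℕ → ℕ
  partlyPeeled K j zero    = 0
  partlyPeeled K j (suc p) = j ℕ.+ K ℕ.* p

  -- Scaled diagrams and powers of the transfer matrix

  module _ (K : ℕ) (ps : List ℕ) where

    private
      shape : ℕ → List ℕ
      shape j = map (partlyPeeled K j) ps

      pred-shape : ∀ j → map pred (shape (suc j)) ≡ shape j
      pred-shape j = trans (sym (List.map-∘ ps)) (List.map-cong (λ { zero → refl ; (suc p) → refl }) ps)

      -- While a column of the block remains, the nonempty rows are exactly those of `ps`, so every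
      -- step uses the same matrix.
      firstColumns-shape : ∀ j → firstColumns {n} (shape (suc j)) ≡ firstColumns ps
      firstColumns-shape j = firstColumns-pattern
        (trans (sym (List.map-∘ ps)) (List.map-cong (λ { zero → refl ; (suc p) → refl }) ps))

      step-shape : ∀ j s → g≤ s (shape (suc j)) ≈ ∑[ firstColumns ps ] λ u → transfer s u * g≤ u (shape j)
      step-shape j s = ≈-trans (g≤-firstColumn s (shape (suc j))) (≈-reflexive
        (cong₂ (λ us qs → ∑[ us ] λ u → transfer s u * g≤ u qs) (firstColumns-shape j) (pred-shape j)))

    -- Iterates the one-column step over the block. Removing j + 1 columns matches `power` at `j`,
    -- which is the (j+1)-st matrix power.
    g≤-power : ∀ j s →
      g≤ s (shape (suc j)) ≈ ∑[ firstColumns ps ] λ t → power ps t s j * g≤ t (shape 0)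
    g≤-power zero    s = step-shape 0 s
    g≤-power (suc j) s = begin
      g≤ s (shape (suc (suc j)))
        ≈⟨ step-shape (suc j) s ⟩
      ∑[ U ] (λ u → transfer s u * g≤ u (shape (suc j)))
        ≈⟨ ∑-cong U (λ u → ≈-trans (*-congˡ (g≤-power j u)) (*-∑ U (transfer s u) _)) ⟩
      ∑[ U ] (λ u → ∑[ U ] λ t → transfer s u * (power ps t u j * g≤ t (shape 0)))
        ≈⟨ ∑-swap U U _ ⟩
      ∑[ U ] (λ t → ∑[ U ] λ u → transfer s u * (power ps t u j * g≤ t (shape 0)))
        ≈⟨ ∑-cong U (λ t → ≈-trans (∑-cong U λ u → ≈-sym (*-assoc _ _ _))
             (≈-sym (∑-* U (λ u → transfer s u * power ps t u j) _))) ⟩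
      ∑[ U ] (λ t → power ps t s (suc j) * g≤ t (shape 0)) ∎
      where U = firstColumns ps

  -- The first column of the unscaled diagram becomes a block of `suc k` columns. Removing the whole
  -- block leaves the same scaling of the diagram without that column, so k enters only through the
  -- power and the smaller diagram.
  g≤-scale : ∀ k s ps → g≤ s (map (suc k ℕ.*_) ps) ≈
    ∑[ firstColumns ps ] λ t → power ps t s k * g≤ t (map (suc k ℕ.*_) (map pred ps))
  g≤-scale k s ps = ≈-trans
    (≈-reflexive (cong (g≤ s) (List.map-cong full ps)))
    (≈-trans (g≤-power (suc k) ps k s)
      (≈-reflexive (cong (λ qs → ∑[ firstColumns ps ] λ t → power ps t s k * g≤ t qs)
        (trans (List.map-cong none ps) (List.map-∘ ps)))))
    where
    full : ∀ p → suc k ℕ.* p ≡ partlyPeeled (suc k) (suc k) p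
    full zero    = ℕ.*-zeroʳ (suc k)
    full (suc p) = ℕ.*-suc (suc k) p

    none : ∀ p → partlyPeeled (suc k) 0 p ≡ suc k ℕ.* pred p
    none zero    = sym (ℕ.*-zeroʳ (suc k))
    none (suc p) = refl

  -- Induction on a bound for the number of columns of the unscaled diagram, for all `s` at once
  -- because the bound changes to `t`. With no columns, scaling does nothing and the sequence is
  -- constant; otherwise it is a finite sum of products of recurrent sequences.
  g≤-splitRecurrent : ∀ L ps → All (_≤ L) ps → ∀ s → SplitRecurrent (λ k → g≤ s (map (suc k ℕ.*_) ps))
  g≤-splitRecurrent zero ps ps≤0 s =
    resp (λ k → ≈-reflexive (cong (g≤ s) (sym (scale-zeros k ps≤0)))) (const (g≤ s ps))
    where
    scale-zeros : ∀ k {ps} → All (_≤ 0) ps → map (suc k ℕ.*_) ps ≡ ps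
    scale-zeros k []           = refl
    scale-zeros k (z≤n ∷ ps≤0) = cong₂ _∷_ (ℕ.*-zeroʳ (suc k)) (scale-zeros k ps≤0)
  g≤-splitRecurrent (suc L) ps ps≤1+L s = resp (λ k → ≈-sym (g≤-scale k s ps))
    (sum (firstColumns ps) λ t → power-splitRecurrent ps t s ⊠
      g≤-splitRecurrent L (map pred ps) (All.map⁺ (All.map ℕ.pred-mono-≤ ps≤1+L)) t)

-- Specialisation to dual stable Grothendieck polynomials

≤-largestPart : ∀ ps → All (_≤ largestPart ps) ps
≤-largestPart []       = []
≤-largestPart (p ∷ ps) =
  ℕ.m≤m⊔n p _ ∷ All.map (λ q≤ → ℕ.≤-trans q≤ (ℕ.m≤n⊔m p _)) (≤-largestPart ps)

-- Addition of polynomials is concatenation, so the right-hand side is a sum of indicator terms in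
-- the polynomial ring. The filtered list equals it as a list, and the predicate may be replaced by
-- an equivalent one.
map-filter : ∀ {A B : Set} {P Q : A → Set} (P? : Decidable P) (Q? : Decidable Q) →
  (∀ x → P x ⇔ Q x) → ∀ (f : A → B) xs →
  map f (filter P? xs) ≡ List.foldr (λ x ys → (if does (Q? x) then f x ∷ [] else []) ++ ys) [] xs
map-filter P? Q? P⇔Q f []       = refl
map-filter P? Q? P⇔Q f (x ∷ xs) with P? x | Q? x
... | yes _ | yes _ = cong (f x ∷_) (map-filter P? Q? P⇔Q f xs)
... | no _  | no _  = map-filter P? Q? P⇔Q f xs
... | yes p | no ¬q = contradiction (Equivalence.to (P⇔Q x) p) ¬q
... | no ¬p | yes q = contradiction (Equivalence.from (P⇔Q x) q) ¬p

module _ (n : ℕ) where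

  monomial : Exponent n → Polynomial n
  monomial e = (x^ e) ∷ []

  monomial-+ : ∀ e f → monomial (Vec.zipWith ℕ._+_ e f) Defs.≈ monomial e Defs.* monomial f
  monomial-+ e f m = refl

  open GeneratingFunction (Polynomials.polynomialRing n) monomial monomial-+

  dualStableGrothendieck≡g≤ : ∀ π →
    dualStableGrothendieck n π ≡ g≤ (replicate (length (parts π)) n) (parts π)
  dualStableGrothendieck≡g≤ π = map-filter isRPP? (isRPPBelow? (replicate (length (parts π)) n))
    (λ T → mk⇔ (_, firstColumn-bound T) proj₁) (λ T → x^ ev T) (allFillings n (parts π))

mainTheorem5 : ∀ (n : ℕ) → n ≥ 1 → (π : Partition) →
    SatisfiesLinearRecurrence (λ k → dualStableGrothendieck n (k · π))
mainTheorem5 n _ π = splitRecurrent⇒recurrence {a = λ k → dualStableGrothendieck n (k · π)}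
  -- The recurrent sequence is indexed from 0 and its k-th term is the polynomial for (k+1)·π, hence
  -- `eq (suc k)`.
  (resp (λ k m → cong (λ p → coeff p m) (sym (eq (suc k))))
    (g≤-splitRecurrent (largestPart (parts π)) (parts π) (≤-largestPart (parts π))
      (replicate (length (parts π)) n)))
  where
  open GeneratingFunction (Polynomials.polynomialRing n) (monomial n) (monomial-+ n)
  open Recurrence (Polynomials.polynomialRing n)

  eq : ∀ k → dualStableGrothendieck n (k · π) ≡
    g≤ (replicate (length (parts π)) n) (map (k ℕ.*_) (parts π))
  -- Scaling keeps the number of parts, so one bounding column serves for every k.
  eq k = trans (dualStableGrothendieck≡g≤ n (k · π))
    (cong (λ l → g≤ (replicate l n) (map (k ℕ.*_) (parts π))) (List.length-map (k ℕ.*_) (parts π)))
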